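{- For any graph $G$ with $\Delta(G)\geq 2$, we have $$\alpha_{\rm es}(G) \leq \frac{\Delta(G)(\Delta(G)-1)}{\Delta(G)^2+\Delta(G)(\delta(G)-1)+\delta(G)}\,n(G),$$ and this bound is sharp (that is, there exist graphs $G$ with $\Delta(G)\ge 2$ for which equality holds).
   Context: All graphs are finite and simple; $n(G)$, $\Delta(G)$ and $\delta(G)$ are the number of vertices, maximum degree and minimum degree of $G$. For $B\subseteq V(G)$, $N[B]=\bigcup_{b\in B}N[b]$ and $N(B)=N[B]- B$. A set $B\subseteq V(G)$ is an externally supported independence set (ESI-set) if $B$ is independent and every $v\in N(B)$ has a neighbor in $V(G)- N[B]$ (the empty set is an ESI-set); $\alpha_{\rm es}(G)$ is the maximum cardinality of an ESI-set of $G$. -}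

module Defs where

open import Data.Fin.Base using (Fin)
open import Data.Fin.Properties using (any?)
open import Data.Fin.Subset using (Subset; _∈_; ⁅_⁆; _∪_; _─_; ∁; ⋃; ∣_∣)
open import Data.Fin.Subset.Properties using (_∈?_; Lift?; anySubset?)
open import Data.Integer.Base as ℤ using (ℤ; +_; +[1+_]; _+_; _*_; _-_)
import Data.Integer.Properties as ℤₚ
open import Data.Integer.Tactic.RingSolver using (solve-∀)
open import Data.List.Base using (List; map; filter; allFin; upTo)
open import Data.List.Extrema.Nat using (max; min)
open import Data.Nat.Base as ℕ using (ℕ; suc; _≤_; s≤s)
import Data.Nat.Properties as ℕₚ
open import Data.Product.Base using (∃-syntax; _×_)
open import Data.Rational.Base as ℚ using (ℚ; _÷_)
import Data.Rational.Properties as ℚₚ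
open import Data.Vec.Base using (tabulate)
open import Level using (0ℓ)
open import Relation.Binary.Core using (Rel)
open import Relation.Binary.Definitions using (Symmetric; Irreflexive; Decidable)
open import Relation.Binary.PropositionalEquality using (_≡_; refl; sym; trans; subst)
open import Relation.Nullary.Decidable using (Dec; does; ¬?; _×-dec_)
open import Relation.Nullary.Negation using (¬_)

record Graph : Set₁ where
  infix 4 _~_ _~?_
  field
    order    : ℕ
    _~_      : Rel (Fin order) 0ℓ
    _~?_     : Decidable _~_
    ~-sym    : Symmetric _~_
    ~-irrefl : Irreflexive _≡_ _~_

  Vertex : Set
  Vertex = Fin order

  nbhd : Vertex → Subset order
  nbhd v = tabulate λ w → does (v ~? w)

  nbhd[_] : Vertex → Subset order
  nbhd[ v ] = ⁅ v ⁆ ∪ nbhd v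

  N[_] : Subset order → Subset order
  N[ B ] = ⋃ (map nbhd[_] (filter (_∈? B) (allFin order)))

  N : Subset order → Subset order
  N B = N[ B ] ─ B

  degree : Vertex → ℕ
  degree v = ∣ nbhd v ∣

  degrees : List ℕ
  degrees = map degree (allFin order)

  Δ : ℕ
  Δ = max 0 degrees

  -- Every degree is less than the order, so the default value `order` is
  -- the result only when there are no vertices.
  δ : ℕ
  δ = min order degrees

  Independent : Subset order → Set
  Independent B = ∀ {u} → u ∈ B → ∀ {v} → v ∈ B → ¬ (u ~ v)

  ExternallySupported : Subset order → Set
  ExternallySupported B = ∀ {v} → v ∈ N B → ∃[ w ] v ~ w × w ∈ ∁ N[ B ]

  ESI : Subset order → Set
  ESI B = Independent B × ExternallySupported B

  ESI? : ∀ B → Dec (ESI B)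
  ESI? B =
    Lift? (λ u → Lift? (λ v → ¬? (u ~? v)) B) B
    ×-dec
    Lift? (λ v → any? λ w → (v ~? w) ×-dec (w ∈? ∁ N[ B ])) (N B)

  ESIOfSize : ℕ → Set
  ESIOfSize k = ∃[ B ] ESI B × ∣ B ∣ ≡ k

  ESIOfSize? : ∀ k → Dec (ESIOfSize k)
  ESIOfSize? k = anySubset? λ B → ESI? B ×-dec (∣ B ∣ ℕₚ.≟ k)

  -- The default 0 is harmless: the empty set is an ESI-set.
  αₑₛ : ℕ
  αₑₛ = max 0 (filter ESIOfSize? (upTo (suc order)))

open Graph public using (order; Δ; δ; αₑₛ)

fromℤ : ℤ → ℚ
fromℤ i = i ℚ./ 1

fromℕ : ℕ → ℚ
fromℕ n = fromℤ (+ n)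

numerator : ℕ → ℤ
numerator Δ = + Δ * (+ Δ - + 1)

-- Integer rather than truncated subtraction, since δ may be 0.
denominator : ℕ → ℕ → ℤ
denominator Δ δ = + Δ * + Δ + + Δ * (+ δ - + 1) + + δ

denominator-positive : ∀ {Δ} δ → 2 ≤ Δ → ℤ.Positive (denominator Δ δ)
denominator-positive {suc (suc d)} δ (s≤s (s≤s _)) =
  subst ℤ.Positive (sym (trans (expand (+ d) (+ δ)) collect)) _
  where
  expand : ∀ d e →
    (+ 2 + d) * (+ 2 + d) + (+ 2 + d) * (e - + 1) + e ≡
    + 2 + (d * d + + 3 * d + (d * e + + 3 * e))
  expand = solve-∀

  collect :
    + 2 + (+ d * + d + + 3 * + d + (+ d * + δ + + 3 * + δ)) ≡
    + (2 ℕ.+ (d ℕ.* d ℕ.+ 3 ℕ.* d ℕ.+ (d ℕ.* δ ℕ.+ 3 ℕ.* δ)))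
  collect rewrite ℤₚ.+◃n≡+n (d ℕ.* d) | ℤₚ.+◃n≡+n (3 ℕ.* d)
                | ℤₚ.+◃n≡+n (d ℕ.* δ) | ℤₚ.+◃n≡+n (3 ℕ.* δ) = refl

fromℤ-nonZero : ∀ i → ℤ.Positive i → ℚ.NonZero (fromℤ i)
fromℤ-nonZero +[1+ n ] _ =
  ℚₚ.pos⇒nonZero (fromℤ +[1+ n ]) {{ℚₚ.normalize-pos (suc n) 1}}

coefficient : (Δ δ : ℕ) → 2 ≤ Δ → ℚ
coefficient Δ δ 2≤Δ = fromℤ (numerator Δ) ÷ fromℤ (denominator Δ δ)
  where
  instance
    nonZero : ℚ.NonZero (fromℤ (denominator Δ δ))
    nonZero = fromℤ-nonZero (denominator Δ δ) (denominator-positive δ 2≤Δ)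

{-# OPTIONS --safe #-}

-- Let B be an ESI-set, A = N(B) and C = V − N[B].  All edges leaving B end in
-- A, and each vertex of A spends one of its at most Δ edges on C, so counting
-- the edges between B and A gives δ|B| ≤ (Δ − 1)|A|, and counting those between
-- A and C gives |A| ≤ Δ|C|.  Substituting both in n = |B| + |A| + |C| yields the
-- bound.  The path on five vertices, with B its two ends, attains it.
module Submission where

open import Defs
open import Algebra.Properties.Semiring.Sum as SemiringSum using ()
open import Data.Bool.Base using (Bool; true; false; _∧_)
open import Data.Fin.Base using (Fin; zero; suc; toℕ)
open import Data.Fin.Subset using (Subset; _∈_; _⊆_; _∩_; _─_; ∁; ⋃; ∣_∣)
open import Data.Fin.Subset.Properties
  using (_∈?_; drop-∷-⊆; p⊆p∪q; q⊆p∪q; p∩q⊆p; p∩q⊆q; x∈p∩q⁺; x∈⁅x⁆; x∈⁅y⁆⇒x≡y; x∈∁p⇒x∉p;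
         x∈p∧x∉q⇒x∈p─q; p⊆q⇒∣p∣≤∣q∣; p⊂q⇒∣p∣<∣q∣; ∣⁅x⁆∣≡1; ∣p∣≤n; ∣p∩q∣≤∣p∣; ∣∁p∣≡n∸∣p∣)
open import Data.Integer.Base as ℤ using (ℤ; +_)
import Data.Integer.Properties as ℤₚ
open import Data.Integer.Tactic.RingSolver using (solve-∀)
open import Data.List.Base using (List; _∷_; upTo)
open import Data.List.Extrema.Nat using (argmax-all; min≤xs; xs≤max)
open import Data.List.Membership.Propositional as List using ()
open import Data.List.Membership.Propositional.Properties
  using (∈-allFin; ∈-filter⁺; ∈-map⁺)
import Data.List.Relation.Unary.All as All
open import Data.List.Relation.Unary.All.Properties using (all-filter)
open import Data.List.Relation.Unary.Any using (here; there)
open import Data.Nat.Base as ℕ using (ℕ; zero; suc; _≤_; z≤n; s≤s)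
open import Data.Nat.Coprimality using (1-coprimeTo) renaming (sym to coprime-sym)
import Data.Nat.Properties as ℕₚ
open import Data.Nat.Tactic.RingSolver renaming (solve-∀ to solve-∀ℕ)
open import Data.Product.Base using (_×_; Σ-syntax; ∃-syntax; _,_; proj₁; proj₂)
open import Data.Rational.Base as ℚ using (mkℚ; *≤*; _*_; _÷_; 1/_)
import Data.Rational.Properties as ℚₚ
open import Data.Sum.Base using (_⊎_; inj₁; inj₂; swap)
open import Data.Vec.Base as Vec using ([]; _∷_; lookup)
open import Data.Vec.Properties
  using (lookup⇒[]=; []=⇒lookup; lookup∘tabulate; lookup-zipWith)
open import Function.Base using (_∘_; id)
open import Function.Bundles using (mk⇔)
open import Relation.Binary.PropositionalEquality
  using (_≡_; refl; sym; trans; cong; cong₂; subst; subst₂; module ≡-Reasoning)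
open import Relation.Nullary.Decidable using (yes; does; _⊎-dec_; dec-true; does-⇔)

open SemiringSum ℕₚ.+-*-semiring

private
  variable
    m n : ℕ

-- Cardinalities as sums of indicators, and double counting.

indicator : Bool → ℕ
indicator false = 0
indicator true  = 1

indicator-∧ : ∀ a b → indicator (a ∧ b) ≡ indicator a ℕ.* indicator b
indicator-∧ false b = refl
indicator-∧ true  b = sym (ℕₚ.*-identityˡ (indicator b))

∣p∣≡∑ : (p : Subset n) → ∣ p ∣ ≡ ∑[ i < n ] indicator (lookup p i)
∣p∣≡∑ []          = refl
∣p∣≡∑ (true  ∷ p) = cong suc (∣p∣≡∑ p)
∣p∣≡∑ (false ∷ p) = ∣p∣≡∑ p

∣p∩q∣≡∑ : (p q : Subset n) →
          ∣ p ∩ q ∣ ≡ ∑[ i < n ] (indicator (lookup p i) ℕ.* indicator (lookup q i))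
∣p∩q∣≡∑ p q = trans (∣p∣≡∑ (p ∩ q)) (sum-cong-≗ λ i →
  trans (cong indicator (lookup-zipWith _∧_ i p q)) (indicator-∧ (lookup p i) (lookup q i)))

sum-mono-≤ : {f g : Fin n → ℕ} → (∀ i → f i ≤ g i) → sum f ≤ sum g
sum-mono-≤ {zero}  f≤g = z≤n
sum-mono-≤ {suc n} f≤g = ℕₚ.+-mono-≤ (f≤g zero) (sum-mono-≤ (f≤g ∘ suc))

∑-subset-mono-≤ : (p : Subset n) {f g : Fin n → ℕ} → (∀ {i} → i ∈ p → f i ≤ g i) →
                  ∑[ i < n ] (indicator (lookup p i) ℕ.* f i) ≤
                  ∑[ i < n ] (indicator (lookup p i) ℕ.* g i)
∑-subset-mono-≤ p {f} {g} f≤g = sum-mono-≤ λ i → term i (lookup p i) refl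
  where
  -- Taking the bit as a separate argument with an equation lets the indicator compute, while
  -- membership in `p` can still be recovered in the `true` case.
  term : ∀ i b → lookup p i ≡ b → indicator b ℕ.* f i ≤ indicator b ℕ.* g i
  term i false _    = z≤n
  term i true  p[i] = ℕₚ.*-monoʳ-≤ 1 (f≤g (lookup⇒[]= i p p[i]))

-- Both products are compared with the number of pairs (`i`, `j`) in `p` × `q` for which `j` lies in
-- `row i`: summed by rows this is at least the left side, and summed by columns at most the right
-- side. The hypothesis on `row` and `col` makes them one incidence matrix and its transpose.
double-counting :
  (row : Fin m → Subset n) (col : Fin n → Subset m) →
  (∀ i j → lookup (row i) j ≡ lookup (col j) i) →
  (p : Subset m) (q : Subset n) (h k : ℕ) →
  (∀ {i} → i ∈ p → h ≤ ∣ row i ∩ q ∣) →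
  (∀ {j} → j ∈ q → ∣ col j ∩ p ∣ ≤ k) →
  ∣ p ∣ ℕ.* h ≤ ∣ q ∣ ℕ.* k
double-counting {m} {n} row col transpose p q h k lower upper = begin
  ∣ p ∣ ℕ.* h                                     ≡⟨ size-* p h ⟩
  ∑[ i < m ] (P i ℕ.* h)                          ≤⟨ ∑-subset-mono-≤ p lower ⟩
  ∑[ i < m ] (P i ℕ.* ∣ row i ∩ q ∣)              ≡⟨ sum-cong-≗ (λ i → expand (P i) (row i) q) ⟩
  ∑[ i < m ] ∑[ j < n ] (P i ℕ.* (R i j ℕ.* Q j)) ≡⟨ ∑-comm (λ i j → P i ℕ.* (R i j ℕ.* Q j)) ⟩
  ∑[ j < n ] ∑[ i < m ] (P i ℕ.* (R i j ℕ.* Q j)) ≡⟨ sum-cong-≗ (λ j → sum-cong-≗ (λ i → flip i j)) ⟩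
  ∑[ j < n ] ∑[ i < m ] (Q j ℕ.* (C j i ℕ.* P i)) ≡⟨ sum-cong-≗ (λ j → expand (Q j) (col j) p) ⟨
  ∑[ j < n ] (Q j ℕ.* ∣ col j ∩ p ∣)              ≤⟨ ∑-subset-mono-≤ q upper ⟩
  ∑[ j < n ] (Q j ℕ.* k)                          ≡⟨ size-* q k ⟨
  ∣ q ∣ ℕ.* k                                     ∎
  where
  open ℕₚ.≤-Reasoning

  P : Fin m → ℕ
  P i = indicator (lookup p i)

  Q : Fin n → ℕ
  Q j = indicator (lookup q j)

  R : Fin m → Fin n → ℕ
  R i j = indicator (lookup (row i) j)

  C : Fin n → Fin m → ℕ
  C j i = indicator (lookup (col j) i)

  size-* : ∀ {l} (r : Subset l) c → ∣ r ∣ ℕ.* c ≡ ∑[ i < l ] (indicator (lookup r i) ℕ.* c)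
  size-* r c = trans (cong (ℕ._* c) (∣p∣≡∑ r)) (*-distribʳ-sum c (indicator ∘ lookup r))

  expand : ∀ {l} c (r s : Subset l) →
           c ℕ.* ∣ r ∩ s ∣ ≡
           ∑[ i < l ] (c ℕ.* (indicator (lookup r i) ℕ.* indicator (lookup s i)))
  expand c r s = trans (cong (c ℕ.*_) (∣p∩q∣≡∑ r s))
    (*-distribˡ-sum c (λ i → indicator (lookup r i) ℕ.* indicator (lookup s i)))

  reorder : ∀ a b c → a ℕ.* (b ℕ.* c) ≡ c ℕ.* (b ℕ.* a)
  reorder = solve-∀ℕ

  flip : ∀ i j → P i ℕ.* (R i j ℕ.* Q j) ≡ Q j ℕ.* (C j i ℕ.* P i)
  flip i j = trans (reorder (P i) (R i j) (Q j))
    (cong (λ b → Q j ℕ.* (indicator b ℕ.* P i)) (transpose i j))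

-- Unions, differences and complements of finite subsets.

x∈⋃⁺ : ∀ {x : Fin n} {p} {ps : List (Subset n)} → p List.∈ ps → x ∈ p → x ∈ ⋃ ps
x∈⋃⁺ {ps = p ∷ ps} (here refl) x∈p = p⊆p∪q (⋃ ps) x∈p
x∈⋃⁺ {ps = p ∷ ps} (there q∈)  x∈q = q⊆p∪q p (⋃ ps) (x∈⋃⁺ q∈ x∈q)

∣p─q∣+∣q∣≡∣p∣ : (p q : Subset n) → q ⊆ p → ∣ p ─ q ∣ ℕ.+ ∣ q ∣ ≡ ∣ p ∣
∣p─q∣+∣q∣≡∣p∣ []      []          _   = refl
-- The inclusion applied to the head of `q` forces `a` to be `true`.
∣p─q∣+∣q∣≡∣p∣ (a ∷ p) (true ∷ q)  q⊆p with a | q⊆p Vec.here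
... | true | _ = trans (ℕₚ.+-suc _ _) (cong suc (∣p─q∣+∣q∣≡∣p∣ p q (drop-∷-⊆ q⊆p)))
∣p─q∣+∣q∣≡∣p∣ (true  ∷ p) (false ∷ q) q⊆p = cong suc (∣p─q∣+∣q∣≡∣p∣ p q (drop-∷-⊆ q⊆p))
∣p─q∣+∣q∣≡∣p∣ (false ∷ p) (false ∷ q) q⊆p = ∣p─q∣+∣q∣≡∣p∣ p q (drop-∷-⊆ q⊆p)

∣p∣+∣∁p∣≡n : (p : Subset n) → ∣ p ∣ ℕ.+ ∣ ∁ p ∣ ≡ n
∣p∣+∣∁p∣≡n p = trans (cong (∣ p ∣ ℕ.+_) (∣∁p∣≡n∸∣p∣ p)) (ℕₚ.m+[n∸m]≡n (∣p∣≤n p))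

-- Neighbourhoods, and the edge counts around an ESI-set.

module _ (G : Graph) where
  open Graph G hiding (order; Δ; δ; αₑₛ)

  -- The adjacency matrix is its own transpose, so `nbhd` can serve as both `row` and `col` in
  -- `double-counting`.
  nbhd-sym : ∀ u v → lookup (nbhd u) v ≡ lookup (nbhd v) u
  nbhd-sym u v = begin
    lookup (nbhd u) v ≡⟨ lookup∘tabulate _ v ⟩
    does (u ~? v)     ≡⟨ does-⇔ (mk⇔ ~-sym ~-sym) (u ~? v) (v ~? u) ⟩
    does (v ~? u)     ≡⟨ lookup∘tabulate _ u ⟨
    lookup (nbhd v) u ∎
    where open ≡-Reasoning

  ∈-nbhd⁺ : ∀ {u v} → u ~ v → v ∈ nbhd u
  ∈-nbhd⁺ {u} {v} u~v = lookup⇒[]= v (nbhd u)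
    (trans (lookup∘tabulate _ v) (dec-true (u ~? v) u~v))

  ∈-nbhd⁻ : ∀ {u v} → v ∈ nbhd u → u ~ v
  ∈-nbhd⁻ {u} {v} v∈ with u ~? v | trans (sym (lookup∘tabulate (λ w → does (u ~? w)) v)) ([]=⇒lookup v∈)
  ... | yes u~v | _ = u~v

  degree≤Δ : ∀ v → degree v ≤ Δ G
  degree≤Δ v = All.lookup (xs≤max 0 degrees) (∈-map⁺ degree (∈-allFin v))

  δ≤degree : ∀ v → δ G ≤ degree v
  δ≤degree v = All.lookup (min≤xs (order G) degrees) (∈-map⁺ degree (∈-allFin v))

  N[]⁺ : ∀ {B u v} → u ∈ B → v ∈ nbhd[ u ] → v ∈ N[ B ]
  N[]⁺ {B} {u} u∈B = x∈⋃⁺ (∈-map⁺ nbhd[_] (∈-filter⁺ (_∈? B) (∈-allFin u) u∈B))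

  ⊆-N[] : ∀ {B} → B ⊆ N[ B ]
  ⊆-N[] {B} {u} u∈B = N[]⁺ {B} u∈B (p⊆p∪q (nbhd u) (x∈⁅x⁆ u))

  ~⇒∈N[] : ∀ {B u v} → u ∈ B → u ~ v → v ∈ N[ B ]
  ~⇒∈N[] {B} u∈B u~v = N[]⁺ {B} u∈B (q⊆p∪q _ _ (∈-nbhd⁺ u~v))

  module _ {B} (esi : ESI B) where
    δ∣B∣≤[Δ∸1]∣NB∣ : ∣ B ∣ ℕ.* δ G ≤ ∣ N B ∣ ℕ.* ℕ.pred (Δ G)
    δ∣B∣≤[Δ∸1]∣NB∣ = double-counting nbhd nbhd nbhd-sym B (N B) _ _ lower upper
      where
      lower : ∀ {u} → u ∈ B → δ G ≤ ∣ nbhd u ∩ N B ∣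
      -- Independence keeps the neighbours of `u` out of `B`, so all of `nbhd u` lies in `N B` and
      -- the full degree is counted.
      lower {u} u∈B = ℕₚ.≤-trans (δ≤degree u) (p⊆q⇒∣p∣≤∣q∣ λ v∈ → x∈p∩q⁺
        (v∈ , x∈p∧x∉q⇒x∈p─q (~⇒∈N[] u∈B (∈-nbhd⁻ v∈))
                (λ v∈B → proj₁ esi u∈B v∈B (∈-nbhd⁻ v∈))))

      upper : ∀ {v} → v ∈ N B → ∣ nbhd v ∩ B ∣ ≤ ℕ.pred (Δ G)
      upper {v} v∈NB with w , v~w , w∈∁ ← proj₂ esi v∈NB =
        -- The supporting neighbour `w` lies outside `B`, so `nbhd v ∩ B` is a proper subset of
        -- `nbhd v`; this strictness is what lowers `Δ` to its predecessor.
        ℕₚ.pred-mono-≤ (ℕₚ.≤-trans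
          (p⊂q⇒∣p∣<∣q∣ (p∩q⊆p (nbhd v) B , w , ∈-nbhd⁺ v~w ,
            λ w∈ → x∈∁p⇒x∉p w∈∁ (⊆-N[] (p∩q⊆q (nbhd v) B w∈))))
          (degree≤Δ v))

    -- External support sends at least one edge from each vertex of `N B` to the complement of
    -- `N[ B ]`, and each vertex there receives at most `Δ` of them. The factor 1 is the lower bound
    -- passed to `double-counting`.
    ∣NB∣≤Δ∣∁N[B]∣ : ∣ N B ∣ ℕ.* 1 ≤ ∣ ∁ N[ B ] ∣ ℕ.* Δ G
    ∣NB∣≤Δ∣∁N[B]∣ = double-counting nbhd nbhd nbhd-sym (N B) (∁ N[ B ]) _ _ lower
      (λ {w} _ → ℕₚ.≤-trans (∣p∩q∣≤∣p∣ (nbhd w) (N B)) (degree≤Δ w))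
      where
      lower : ∀ {v} → v ∈ N B → 1 ≤ ∣ nbhd v ∩ ∁ N[ B ] ∣
      lower {v} v∈NB with w , v~w , w∈∁ ← proj₂ esi v∈NB =
        subst (_≤ _) (∣⁅x⁆∣≡1 w) (p⊆q⇒∣p∣≤∣q∣ λ x∈⁅w⁆ →
          subst (_∈ _) (sym (x∈⁅y⁆⇒x≡y w x∈⁅w⁆)) (x∈p∩q⁺ (∈-nbhd⁺ v~w , w∈∁)))

    order-partition : ∣ N B ∣ ℕ.+ ∣ B ∣ ℕ.+ ∣ ∁ N[ B ] ∣ ≡ order G
    order-partition = trans
      (cong (ℕ._+ ∣ ∁ N[ B ] ∣) (∣p─q∣+∣q∣≡∣p∣ N[ B ] B ⊆-N[]))
      (∣p∣+∣∁p∣≡n N[ B ])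

-- Arithmetic of the bound with denominators cleared.

-- With Δ = d + 1, the denominator of the coefficient is (d + 1)d + (d + 2)δ and
-- no subtraction occurs.
partition-bound : ∀ d δ a b c → b ℕ.* δ ≤ a ℕ.* d → a ℕ.* 1 ≤ c ℕ.* suc d →
  b ℕ.* (suc d ℕ.* d ℕ.+ (2 ℕ.+ d) ℕ.* δ) ≤ suc d ℕ.* d ℕ.* (a ℕ.+ b ℕ.+ c)
partition-bound d δ a b c bδ≤ad a≤cΔ = begin
  b ℕ.* (suc d ℕ.* d ℕ.+ (2 ℕ.+ d) ℕ.* δ)           ≡⟨ isolate d δ b ⟩
  suc d ℕ.* d ℕ.* b ℕ.+ (2 ℕ.+ d) ℕ.* (b ℕ.* δ)
    ≤⟨ ℕₚ.+-monoʳ-≤ (suc d ℕ.* d ℕ.* b) (ℕₚ.*-monoʳ-≤ (2 ℕ.+ d) bδ≤ad) ⟩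
  -- As `2 + d` exceeds `suc d` by one, a surplus `d * (a * 1)` is left over; the second inequality
  -- trades it for the missing term in `c`.
  suc d ℕ.* d ℕ.* b ℕ.+ (2 ℕ.+ d) ℕ.* (a ℕ.* d)     ≡⟨ split d a b ⟩
  suc d ℕ.* d ℕ.* (a ℕ.+ b) ℕ.+ d ℕ.* (a ℕ.* 1)
    ≤⟨ ℕₚ.+-monoʳ-≤ (suc d ℕ.* d ℕ.* (a ℕ.+ b)) (ℕₚ.*-monoʳ-≤ d a≤cΔ) ⟩
  suc d ℕ.* d ℕ.* (a ℕ.+ b) ℕ.+ d ℕ.* (c ℕ.* suc d) ≡⟨ merge d a b c ⟩
  suc d ℕ.* d ℕ.* (a ℕ.+ b ℕ.+ c)                   ∎
  where
  open ℕₚ.≤-Reasoning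

  isolate : ∀ d δ b → b ℕ.* (suc d ℕ.* d ℕ.+ (2 ℕ.+ d) ℕ.* δ) ≡
                      suc d ℕ.* d ℕ.* b ℕ.+ (2 ℕ.+ d) ℕ.* (b ℕ.* δ)
  isolate = solve-∀ℕ

  split : ∀ d a b → suc d ℕ.* d ℕ.* b ℕ.+ (2 ℕ.+ d) ℕ.* (a ℕ.* d) ≡
                    suc d ℕ.* d ℕ.* (a ℕ.+ b) ℕ.+ d ℕ.* (a ℕ.* 1)
  split = solve-∀ℕ

  merge : ∀ d a b c → suc d ℕ.* d ℕ.* (a ℕ.+ b) ℕ.+ d ℕ.* (c ℕ.* suc d) ≡
                      suc d ℕ.* d ℕ.* (a ℕ.+ b ℕ.+ c)
  merge = solve-∀ℕ

numerator-suc : ∀ d → numerator (suc d) ≡ + (suc d ℕ.* d)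
numerator-suc d = sym (ℤₚ.pos-* (suc d) d)

denominator-suc : ∀ d δ → denominator (suc d) δ ≡ + (suc d ℕ.* d ℕ.+ (2 ℕ.+ d) ℕ.* δ)
denominator-suc d δ = begin
  denominator (suc d) δ
    ≡⟨ expand (+ d) (+ δ) ⟩
  + suc d ℤ.* + d ℤ.+ + (2 ℕ.+ d) ℤ.* + δ
    ≡⟨ cong₂ ℤ._+_ (ℤₚ.pos-* (suc d) d) (ℤₚ.pos-* (2 ℕ.+ d) δ) ⟨
  + (suc d ℕ.* d ℕ.+ (2 ℕ.+ d) ℕ.* δ) ∎
  where
  open ≡-Reasoning

  expand : ∀ d e → (+ 1 ℤ.+ d) ℤ.* (+ 1 ℤ.+ d) ℤ.+ (+ 1 ℤ.+ d) ℤ.* (e ℤ.- + 1) ℤ.+ e ≡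
                   (+ 1 ℤ.+ d) ℤ.* d ℤ.+ (+ 2 ℤ.+ d) ℤ.* e
  expand = solve-∀

-- For positive `Δ` the truncated `pred Δ` of the edge count agrees with the integer `Δ - 1` of
-- `numerator`: both become `d`.
partition-boundℤ : ∀ Δ δ a b c → 1 ≤ Δ →
  b ℕ.* δ ≤ a ℕ.* ℕ.pred Δ → a ℕ.* 1 ≤ c ℕ.* Δ →
  + b ℤ.* denominator Δ δ ℤ.≤ numerator Δ ℤ.* + (a ℕ.+ b ℕ.+ c)
partition-boundℤ (suc d) δ a b c _ bδ≤ad a≤cΔ = begin
  + b ℤ.* denominator (suc d) δ                            ≡⟨ cong (+ b ℤ.*_) (denominator-suc d δ) ⟩
  + b ℤ.* + (suc d ℕ.* d ℕ.+ (2 ℕ.+ d) ℕ.* δ)              ≡⟨ ℤₚ.pos-* b _ ⟨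
  + (b ℕ.* (suc d ℕ.* d ℕ.+ (2 ℕ.+ d) ℕ.* δ))              ≤⟨ ℤ.+≤+ (partition-bound d δ a b c bδ≤ad a≤cΔ) ⟩
  + (suc d ℕ.* d ℕ.* (a ℕ.+ b ℕ.+ c))                      ≡⟨ ℤₚ.pos-* (suc d ℕ.* d) _ ⟩
  + (suc d ℕ.* d) ℤ.* + (a ℕ.+ b ℕ.+ c)                    ≡⟨ cong (ℤ._* + (a ℕ.+ b ℕ.+ c)) (numerator-suc d) ⟨
  numerator (suc d) ℤ.* + (a ℕ.+ b ℕ.+ c)                  ∎
  where open ℤₚ.≤-Reasoning

-- The maximum defining `αₑₛ` is either its default 0 or the size of an actual ESI-set, so it
-- suffices to check the bound in these two cases.
αₑₛ-bound : (G : Graph) → 1 ≤ Δ G →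
  + αₑₛ G ℤ.* denominator (Δ G) (δ G) ℤ.≤ numerator (Δ G) ℤ.* + order G
αₑₛ-bound G 1≤Δ = argmax-all id {P = Bounded} bounded-0
  (All.map bounded (all-filter ESIOfSize? (upTo (suc (order G)))))
  where
  open Graph G using (ESIOfSize; ESIOfSize?; N; N[_])

  Bounded : ℕ → Set
  Bounded k = + k ℤ.* denominator (Δ G) (δ G) ℤ.≤ numerator (Δ G) ℤ.* + order G

  bounded : ∀ {k} → ESIOfSize k → Bounded k
  bounded (B , esi , refl) =
    subst (λ n → + ∣ B ∣ ℤ.* denominator (Δ G) (δ G) ℤ.≤ numerator (Δ G) ℤ.* + n)
      (order-partition G esi)
      (partition-boundℤ (Δ G) (δ G) (∣ N B ∣) (∣ B ∣) (∣ ∁ N[ B ] ∣) 1≤Δ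
        (δ∣B∣≤[Δ∸1]∣NB∣ G esi) (∣NB∣≤Δ∣∁N[B]∣ G esi))

  -- The default corresponds to the empty set: `a` and `b` are 0 and `c` is the whole order.
  bounded-0 : Bounded 0
  bounded-0 = partition-boundℤ (Δ G) (δ G) 0 0 (order G) 1≤Δ z≤n z≤n

-- Passage from integers to rationals.

-- For a variable `i` the normalisation by a gcd inside `i / 1` does not reduce; the explicit form
-- with denominator 1 does compute.
fromℤ≡mkℚ : ∀ i → fromℤ i ≡ mkℚ i 0 (coprime-sym (1-coprimeTo ℤ.∣ i ∣))
fromℤ≡mkℚ i = ℚₚ.↥p/↧p≡p (mkℚ i 0 (coprime-sym (1-coprimeTo ℤ.∣ i ∣)))

fromℤ-* : ∀ i j → fromℤ i * fromℤ j ≡ fromℤ (i ℤ.* j)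
fromℤ-* i j = cong₂ _*_ (fromℤ≡mkℚ i) (fromℤ≡mkℚ j)

fromℤ-mono-≤ : ∀ {i j} → i ℤ.≤ j → fromℤ i ℚ.≤ fromℤ j
fromℤ-mono-≤ {i} {j} i≤j rewrite fromℤ≡mkℚ i | fromℤ≡mkℚ j =
  *≤* (ℤₚ.*-monoʳ-≤-nonNeg (+ 1) i≤j)

fromℤ-positive : ∀ i → ℤ.Positive i → ℚ.Positive (fromℤ i)
fromℤ-positive ℤ.+[1+ n ] _ = ℚₚ.normalize-pos (suc n) 1

-- Multiplying the goal by the positive `s` cancels `1/ s` and leaves the hypothesis.
p≤r÷s*q⁺ : ∀ p q r s .{{_ : ℚ.NonZero s}} .{{_ : ℚ.Positive s}} →
           p * s ℚ.≤ r * q → p ℚ.≤ (r ÷ s) * q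
p≤r÷s*q⁺ p q r s ps≤rq = ℚₚ.*-cancelʳ-≤-pos s (begin
  p * s                ≤⟨ ps≤rq ⟩
  r * q                ≡⟨ cong (_* q) (ℚₚ.*-identityʳ r) ⟨
  r * ℚ.1ℚ * q         ≡⟨ cong (λ x → r * x * q) (ℚₚ.*-inverseˡ s) ⟨
  r * (1/ s * s) * q   ≡⟨ cong (_* q) (ℚₚ.*-assoc r (1/ s) s) ⟨
  r * 1/ s * s * q     ≡⟨ ℚₚ.*-assoc (r * 1/ s) s q ⟩
  r * 1/ s * (s * q)   ≡⟨ cong (r * 1/ s *_) (ℚₚ.*-comm s q) ⟩
  r * 1/ s * (q * s)   ≡⟨ ℚₚ.*-assoc (r * 1/ s) q s ⟨
  (r ÷ s) * q * s      ∎)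
  where open ℚₚ.≤-Reasoning

-- The extremal path and the theorem.

path : ℕ → Graph
path n = record
  { order    = n
  ; _~_      = λ u v → toℕ v ≡ suc (toℕ u) ⊎ toℕ u ≡ suc (toℕ v)
  ; _~?_     = λ u v → (toℕ v ℕₚ.≟ suc (toℕ u)) ⊎-dec (toℕ u ℕₚ.≟ suc (toℕ v))
  ; ~-sym    = swap
  ; ~-irrefl = λ { refl (inj₁ e) → ℕₚ.1+n≢n (sym e) ; refl (inj₂ e) → ℕₚ.1+n≢n (sym e) }
  }

proposition13 : (∀ (G : Graph) (2≤Δ : 2 ≤ Δ G) →
    fromℕ (αₑₛ G) ℚ.≤ coefficient (Δ G) (δ G) 2≤Δ * fromℕ (order G))
    ×
    (∃[ G ] Σ[ 2≤Δ ∈ 2 ≤ Δ G ]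
    fromℕ (αₑₛ G) ≡ coefficient (Δ G) (δ G) 2≤Δ * fromℕ (order G))
-- The path on five vertices has `Δ` = 2 and `δ` = 1, so the coefficient is 2/5 and the bound is 2.
-- The final `refl` evaluates both sides, including the search over all subsets in `αₑₛ`.
proposition13 = bound , path 5 , s≤s (s≤s z≤n) , refl
  where
  bound : ∀ (G : Graph) (2≤Δ : 2 ≤ Δ G) →
    fromℕ (αₑₛ G) ℚ.≤ coefficient (Δ G) (δ G) 2≤Δ * fromℕ (order G)
  bound G 2≤Δ = p≤r÷s*q⁺ (fromℕ (αₑₛ G)) (fromℕ (order G)) (fromℤ (numerator (Δ G))) (fromℤ D)
    {{fromℤ-nonZero D D-positive}} {{fromℤ-positive D D-positive}}
    (subst₂ ℚ._≤_ (sym (fromℤ-* (+ αₑₛ G) D)) (sym (fromℤ-* (numerator (Δ G)) (+ order G)))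
      (fromℤ-mono-≤ (αₑₛ-bound G (ℕₚ.≤-trans (s≤s z≤n) 2≤Δ))))
    where
    D = denominator (Δ G) (δ G)
    D-positive = denominator-positive (δ G) 2≤Δ
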